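{- Let $R\cong R_1\times\cdots\times R_n$ have finitely many ideals, where each $R_i$ is an Artinian local ring with $|A(R_i)^*|\geq 1$. Then $\mathrm{sdim}_M(\Gamma(R))=|V(\Gamma(R))|-2n+2$.
   Context: Rings are commutative with identity. $A(R_i)$ is the set of ideals of $R_i$ with nonzero annihilator and $A(R_i)^*=A(R_i)\setminus\{0\}$. The co-maximal ideal graph $\Gamma(R)$ has as vertices the proper ideals of $R$ not contained in the Jacobson radical, two distinct vertices $I,J$ adjacent iff $I+J=R$. For a connected graph $G$, a vertex $w$ strongly resolves vertices $u,v$ if there is a shortest $u$–$w$ path containing $v$ or a shortest $v$–$w$ path containing $u$; a strong resolving set is a set $W$ of vertices such that every pair of distinct vertices is strongly resolved by some vertex of $W$; $\mathrm{sdim}_M(G)$ is the minimum cardinality of a strong resolving set. -}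

module Defs where

open import Level using (Level; _⊔_; suc)
open import Algebra.Bundles using (CommutativeRing)
open import Data.Nat as ℕ using (ℕ; _≤_)
open import Data.Fin using (Fin)
open import Data.Fin.Subset using (Subset; _∈_; ∣_∣)
open import Data.Product using (Σ; ∃; _×_; _,_)
open import Data.Sum using (_⊎_)
open import Relation.Nullary using (¬_)
open import Relation.Binary.PropositionalEquality using (_≡_; _≢_)

module RingNotions {c ℓ : Level} (R : CommutativeRing c ℓ) where
  open CommutativeRing R

  record Ideal : Set (suc (c ⊔ ℓ)) where
    field
      mem   : Carrier → Set (c ⊔ ℓ)
      resp  : ∀ {x y} → x ≈ y → mem x → mem y
      has0  : mem 0#
      add   : ∀ {x y} → mem x → mem y → mem (x + y)
      mulˡ  : ∀ r {x} → mem x → mem (r * x)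
  open Ideal public

  _⊆I_ : Ideal → Ideal → Set (c ⊔ ℓ)
  I ⊆I J = ∀ x → mem I x → mem J x

  _≐_ : Ideal → Ideal → Set (c ⊔ ℓ)
  I ≐ J = (I ⊆I J) × (J ⊆I I)

  Proper : Ideal → Set (c ⊔ ℓ)
  Proper I = ¬ mem I 1#

  Maximal : Ideal → Set (suc (c ⊔ ℓ))
  Maximal M = Proper M × (∀ J → M ⊆I J → (J ⊆I M) ⊎ mem J 1#)

  InJacobson : Carrier → Set (suc (c ⊔ ℓ))
  InJacobson x = ∀ M → Maximal M → mem M x

  ⊆Jacobson : Ideal → Set (suc (c ⊔ ℓ))
  ⊆Jacobson I = ∀ x → mem I x → InJacobson x

  Comaximal : Ideal → Ideal → Set (c ⊔ ℓ)
  Comaximal I J = ∃ λ a → ∃ λ b → mem I a × mem J b × (a + b ≈ 1#)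

  -- vertices of the co-maximal ideal graph Γ(R)
  IsVertex : Ideal → Set (suc (c ⊔ ℓ))
  IsVertex I = Proper I × ¬ ⊆Jacobson I

  FinitelyManyIdeals : Set (suc (c ⊔ ℓ))
  FinitelyManyIdeals = ∃ λ (m : ℕ) → Σ (Fin m → Ideal) λ Is → ∀ I → ∃ λ j → I ≐ Is j

  Artinian : Set (suc (c ⊔ ℓ))
  Artinian = ∀ (I : ℕ → Ideal) → (∀ m → I (ℕ.suc m) ⊆I I m) →
             ∃ λ N → ∀ m → N ≤ m → I N ⊆I I m

  Local : Set (suc (c ⊔ ℓ))
  Local = ∃ λ M → Maximal M × (∀ M′ → Maximal M′ → M′ ≐ M)

  HasNonzeroAnnihilatingIdeal : Set (suc (c ⊔ ℓ))
  HasNonzeroAnnihilatingIdeal =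
    ∃ λ I → (∃ λ x → mem I x × ¬ (x ≈ 0#)) ×
            (∃ λ r → ¬ (r ≈ 0#) × (∀ x → mem I x → r * x ≈ 0#))

  -- (vs : Fin k → Ideal) lists the vertices of Γ(R) exactly once each,
  -- so |V(Γ(R))| = k
  VertexEnumeration : (k : ℕ) → (Fin k → Ideal) → Set (suc (c ⊔ ℓ))
  VertexEnumeration k vs =
    (∀ j → IsVertex (vs j)) ×
    (∀ I → IsVertex I → ∃ λ j → I ≐ vs j) ×
    (∀ i j → i ≢ j → ¬ (vs i ≐ vs j))

  ΓAdj : ∀ {k} → (Fin k → Ideal) → Fin k → Fin k → Set (c ⊔ ℓ)
  ΓAdj vs i j = (i ≢ j) × Comaximal (vs i) (vs j)

IsoToProduct : ∀ {c ℓ} (R : CommutativeRing c ℓ) (n : ℕ)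
               (Rs : Fin n → CommutativeRing c ℓ) → Set (c ⊔ ℓ)
IsoToProduct R n Rs =
  Σ (Carrier R → (i : Fin n) → Carrier (Rs i)) λ φ →
    (∀ {x y} i → _≈_ R x y → _≈_ (Rs i) (φ x i) (φ y i)) ×
    (∀ x y i → _≈_ (Rs i) (φ (_+_ R x y) i) (_+_ (Rs i) (φ x i) (φ y i))) ×
    (∀ x y i → _≈_ (Rs i) (φ (_*_ R x y) i) (_*_ (Rs i) (φ x i) (φ y i))) ×
    (∀ i → _≈_ (Rs i) (φ (1# R) i) (1# (Rs i))) ×
    (∀ x y → (∀ i → _≈_ (Rs i) (φ x i) (φ y i)) → _≈_ R x y) ×
    (∀ (f : (i : Fin n) → Carrier (Rs i)) → ∃ λ x → ∀ i → _≈_ (Rs i) (φ x i) (f i))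
  where open CommutativeRing

module GraphNotions {a : Level} {k : ℕ} (Adj : Fin k → Fin k → Set a) where

  data Walk : Fin k → Fin k → ℕ → Set a where
    []  : ∀ {u} → Walk u u 0
    _∷_ : ∀ {u v w l} → Adj u v → Walk v w l → Walk u w (ℕ.suc l)

  data OnWalk (x : Fin k) : ∀ {u w l} → Walk u w l → Set a where
    here  : ∀ {w l} (p : Walk x w l) → OnWalk x p
    there : ∀ {u v w l} (e : Adj u v) {p : Walk v w l} → OnWalk x p → OnWalk x (e ∷ p)

  Shortest : ∀ {u w l} → Walk u w l → Set a
  Shortest {u} {w} {l} _ = ∀ l′ → Walk u w l′ → l ≤ l′

  OnShortest : Fin k → Fin k → Fin k → Set a
  OnShortest u w v = ∃ λ l → Σ (Walk u w l) λ p → Shortest p × OnWalk v p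

  StronglyResolves : Fin k → Fin k → Fin k → Set a
  StronglyResolves w u v = OnShortest u w v ⊎ OnShortest v w u

  StrongResolvingSet : Subset k → Set a
  StrongResolvingSet W = ∀ u v → u ≢ v → ∃ λ w → w ∈ W × StronglyResolves w u v

  HasSdim : ℕ → Set a
  HasSdim s = (∃ λ W → StrongResolvingSet W × ∣ W ∣ ≡ s) ×
              (∀ W → StrongResolvingSet W → s ≤ ∣ W ∣)

{-# OPTIONS --safe #-}

-- An ideal of R is determined up to comaximality by its cosupport, the set of factors on which it is
-- proper: vertices have nonempty proper cosupports, every such set occurs at least twice because the
-- maximal ideals of the factors are nonzero, and adjacency is disjointness of cosupports.  Two vertices
-- u ≠ v outside a strong resolving set have distinct cosupports that are disjoint or nested; conversely
-- any set of vertices with these properties has a strongly resolving complement.  So the complements of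
-- minimum strong resolving sets correspond to the largest laminar families of nonempty proper subsets
-- of an n-element set, and these have 2n - 2 members.

module Submission where

open import Defs
open import Level using (Level; _⊔_; lift)
open import Algebra.Bundles using (CommutativeRing)
open import Data.Bool using (Bool; true; false)
import Data.Bool.Properties as Bool
open import Data.Empty using (⊥-elim)
open import Data.Fin using (Fin; zero; suc; punchIn; _≟_)
open import Data.Fin.Properties
  using (any?; ¬∀⟶∃¬; punchIn-injective; punchInᵢ≢i; injective⇒≤; suc-injective)
open import Data.Fin.Subset
  using (Subset; inside; outside; _∈_; _∉_; _⊆_; Nonempty; ∣_∣; ∁; ⁅_⁆; ⊥; ⊤)
open import Data.Fin.Subset.Properties
open import Data.Nat as ℕ using (ℕ; zero; suc; NonZero; _≤_; z≤n; s≤s)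
import Data.Nat.Properties as ℕ
open import Data.Product using (Σ; ∃; ∃₂; _×_; _,_; proj₁; proj₂; map₁; map₂)
open import Data.Sum using (_⊎_; inj₁; inj₂; [_,_]′)
open import Data.Vec using (_∷_; []; head; tail; here; there; tabulate)
import Data.Vec.Properties as Vec
open import Function using (_∘_; id)
open import Function.Definitions using (Injective)
import Relation.Binary.Reasoning.Setoid as ≈-Reasoning
open import Relation.Binary.PropositionalEquality
  using (_≡_; _≢_; refl; sym; trans; cong; subst)
open import Relation.Nullary using (¬_; Dec; yes; no; does; contradiction; ¬?; _×-dec_)
open import Relation.Nullary.Decidable using (dec-true; decidable-stable)

-- Finite subsets: selection, counting, disjointness, inclusion

private variable
  k m n : ℕ
  S T : Subset n

select : ∀ {p} {P : Fin n → Set p} → (∀ i → Dec (P i)) → Subset n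
select P? = tabulate (does ∘ P?)

module _ {p} {P : Fin n → Set p} (P? : ∀ i → Dec (P i)) where

  ∈-select⁺ : ∀ {i} → P i → i ∈ select P?
  ∈-select⁺ {i} pi = Vec.lookup⇒[]= i _ (trans (Vec.lookup∘tabulate _ i) (dec-true (P? i) pi))

  ∈-select⁻ : ∀ {i} → i ∈ select P? → P i
  ∈-select⁻ {i} i∈ with P? i | trans (sym (Vec.lookup∘tabulate (does ∘ P?) i)) (Vec.[]=⇒lookup i∈)
  ... | yes pi | _ = pi

enum : (S : Subset n) → Fin ∣ S ∣ → Fin n
enum (outside ∷ S) i       = suc (enum S i)
enum (inside  ∷ S) zero    = zero
enum (inside  ∷ S) (suc i) = suc (enum S i)

enum-∈ : (S : Subset n) (i : Fin ∣ S ∣) → enum S i ∈ S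
enum-∈ (outside ∷ S) i       = there (enum-∈ S i)
enum-∈ (inside  ∷ S) zero    = here
enum-∈ (inside  ∷ S) (suc i) = there (enum-∈ S i)

enum-injective : (S : Subset n) → Injective _≡_ _≡_ (enum S)
enum-injective (outside ∷ S)                 eq = enum-injective S (suc-injective eq)
enum-injective (inside ∷ S) {zero}  {zero}   eq = refl
enum-injective (inside ∷ S) {suc _} {suc _}  eq = cong suc (enum-injective S (suc-injective eq))

index : ∀ {i} → i ∈ S → Fin ∣ S ∣
index {S = inside  ∷ S} here       = zero
index {S = inside  ∷ S} (there i∈) = suc (index i∈)
index {S = outside ∷ S} (there i∈) = index i∈

index-injective : ∀ {i j} (i∈ : i ∈ S) (j∈ : j ∈ S) → index i∈ ≡ index j∈ → i ≡ j
index-injective {S = inside  ∷ S} here       here       eq = refl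
index-injective {S = inside  ∷ S} (there i∈) (there j∈) eq =
  cong suc (index-injective i∈ j∈ (suc-injective eq))
index-injective {S = outside ∷ S} (there i∈) (there j∈) eq = cong suc (index-injective i∈ j∈ eq)

injective⇒≤∣∣ : {f : Fin m → Fin n} → Injective _≡_ _≡_ f → (∀ i → f i ∈ S) → m ≤ ∣ S ∣
injective⇒≤∣∣ f-inj f∈ = injective⇒≤ {f = λ i → index (f∈ i)} (f-inj ∘ index-injective (f∈ _) (f∈ _))

∣∁p∣+∣p∣≡n : (S : Subset n) → ∣ ∁ S ∣ ℕ.+ ∣ S ∣ ≡ n
∣∁p∣+∣p∣≡n S = trans (cong (ℕ._+ ∣ S ∣) (∣∁p∣≡n∸∣p∣ S)) (ℕ.m∸n+n≡m (∣p∣≤n S))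

Disjoint : Subset n → Subset n → Set
Disjoint S T = ∀ i → i ∈ S → i ∉ T

disjoint-sym : Disjoint S T → Disjoint T S
disjoint-sym S∩T≡∅ i i∈T i∈S = S∩T≡∅ i i∈S i∈T

disjoint⊎meet : (S T : Subset n) → Disjoint S T ⊎ ∃ λ i → i ∈ S × i ∈ T
disjoint⊎meet S T with any? (λ i → i ∈? S ×-dec i ∈? T)
... | yes meet  = inj₂ meet
... | no  ¬meet = inj₁ λ i i∈S i∈T → ¬meet (i , i∈S , i∈T)

⊆⊎⊈ : (S T : Subset n) → S ⊆ T ⊎ ∃ λ i → i ∈ S × i ∉ T
⊆⊎⊈ S T with any? (λ i → i ∈? S ×-dec ¬? (i ∈? T))
... | yes S⊈T = inj₂ S⊈T
... | no  S⊆T = inj₁ λ {i} i∈S → decidable-stable (i ∈? T) λ i∉T → S⊆T (i , i∈S , i∉T)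

-- The size of a laminar family

Laminar : Subset n → Subset n → Set
Laminar S T = Disjoint S T ⊎ S ⊆ T ⊎ T ⊆ S

LaminarFamily : (Fin m → Subset n) → Set
LaminarFamily F = ∀ i j → Laminar (F i) (F j)

laminar-sym : Laminar S T → Laminar T S
laminar-sym (inj₁ S∩T≡∅)      = inj₁ (disjoint-sym S∩T≡∅)
laminar-sym (inj₂ (inj₁ S⊆T)) = inj₂ (inj₂ S⊆T)
laminar-sym (inj₂ (inj₂ T⊆S)) = inj₂ (inj₁ T⊆S)

drop-∷-disjoint : ∀ {a b} → Disjoint (a ∷ S) (b ∷ T) → Disjoint S T
drop-∷-disjoint d i i∈S i∈T = d (suc i) (there i∈S) (there i∈T)

tail-laminar : (S T : Subset (suc n)) → Laminar S T → Laminar (tail S) (tail T)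
tail-laminar (_ ∷ _) (_ ∷ _) (inj₁ d)          = inj₁ (drop-∷-disjoint d)
tail-laminar (_ ∷ _) (_ ∷ _) (inj₂ (inj₁ S⊆T)) = inj₂ (inj₁ (drop-∷-⊆ S⊆T))
tail-laminar (_ ∷ _) (_ ∷ _) (inj₂ (inj₂ T⊆S)) = inj₂ (inj₂ (drop-∷-⊆ T⊆S))

-- Describes a collision of `tail ∘ F`: distinct members with the same tail differ at `zero`, so
-- both extensions of that tail occur.
Doubled : (Fin m → Subset (suc n)) → Subset n → Set
Doubled F S = ∀ b → ∃ λ i → F i ≡ b ∷ S

-- The common element `i` excludes disjointness, and `zero` lies only in the first set; one
-- inclusion remains.
∷-laminar⇒⊇ : ∀ {i} → i ∈ S → i ∈ T → Laminar (inside ∷ S) (outside ∷ T) → T ⊆ S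
∷-laminar⇒⊇ i∈S i∈T (inj₁ d)          = contradiction i∈T (drop-∷-disjoint d _ i∈S)
∷-laminar⇒⊇ i∈S i∈T (inj₂ (inj₁ S⊆T)) with () ← S⊆T here
∷-laminar⇒⊇ i∈S i∈T (inj₂ (inj₂ T⊆S)) = drop-∷-⊆ T⊆S

-- Both sets contain `zero`, so they are nested, and any element of the smaller tail is common.
∷-laminar⇒meet : Nonempty S → Nonempty T → Laminar (inside ∷ S) (inside ∷ T) → ∃ λ i → i ∈ S × i ∈ T
∷-laminar⇒meet _         _         (inj₁ d)          = contradiction here (d zero here)
∷-laminar⇒meet (i , i∈S) _         (inj₂ (inj₁ S⊆T)) = i , i∈S , drop-there (S⊆T (there i∈S))
∷-laminar⇒meet _         (i , i∈T) (inj₂ (inj₂ T⊆S)) = i , drop-there (T⊆S (there i∈T)) , i∈T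

module _ {F : Fin m → Subset (suc n)} (lam : LaminarFamily F) where

  private
    members : ∀ {S T} → Doubled F S → Doubled F T → ∀ a b → Laminar (a ∷ S) (b ∷ T)
    members dS dT a b with dS a | dT b
    ... | i , Fi | j , Fj = subst (λ X → Laminar X _) Fi (subst (Laminar (F i)) Fj (lam i j))

  -- The extensions containing `zero` show that the tails meet. Comparing an extension with `zero`
  -- of one tail to the extension without `zero` of the other then gives each inclusion.
  doubled-unique : Doubled F S → Doubled F T → Nonempty S → Nonempty T → S ≡ T
  doubled-unique dS dT neS neT
    with i , i∈S , i∈T ← ∷-laminar⇒meet neS neT (members dS dT inside inside) =
    ⊆-antisym (∷-laminar⇒⊇ i∈T i∈S (members dT dS inside outside))
              (∷-laminar⇒⊇ i∈S i∈T (members dS dT inside outside))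

  -- The empty tail may be doubled as well, hence two doubled tails but not three.
  doubled-≤2 : ∀ {S T U} → Doubled F S → Doubled F T → Doubled F U →
               S ≢ T → S ≢ U → ¬ T ≢ U
  doubled-≤2 {S} {T} {U} dS dT dU S≢T S≢U T≢U with nonempty? S | nonempty? T | nonempty? U
  ... | yes neS | yes neT | _       = S≢T (doubled-unique dS dT neS neT)
  ... | yes neS | no  _   | yes neU = S≢U (doubled-unique dS dU neS neU)
  ... | no  _   | yes neT | yes neU = T≢U (doubled-unique dT dU neT neU)
  ... | no  eS  | no  eT  | _       = S≢T (trans (Empty-unique eS) (sym (Empty-unique eT)))
  ... | no  eS  | yes _   | no  eU  = S≢U (trans (Empty-unique eS) (sym (Empty-unique eU)))
  ... | yes _   | no  eT  | no  eU  = T≢U (trans (Empty-unique eT) (sym (Empty-unique eU)))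

-- The heads must differ, so each of the two values of `b` is the head of one of the sets.
tail-≡ : {S T : Subset (suc n)} → S ≢ T → tail S ≡ tail T → ∀ b → S ≡ b ∷ tail S ⊎ T ≡ b ∷ tail S
tail-≡ {S = true  ∷ _} {_}         _   _    true  = inj₁ refl
tail-≡ {S = false ∷ _} {_}         _   _    false = inj₁ refl
tail-≡ {S = true  ∷ _} {false ∷ _} _   refl false = inj₂ refl
tail-≡ {S = false ∷ _} {true  ∷ _} _   refl true  = inj₂ refl
tail-≡ {S = true  ∷ _} {true  ∷ _} S≢T refl false = contradiction refl S≢T
tail-≡ {S = false ∷ _} {false ∷ _} S≢T refl true  = contradiction refl S≢T

tail-injective⊎doubled : (F : Fin m → Subset (suc n)) → Injective _≡_ _≡_ F →
  Injective _≡_ _≡_ (tail ∘ F) ⊎ ∃ λ i → Doubled F (tail (F i))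
tail-injective⊎doubled F F-inj
  with any? (λ i → any? (λ j → ¬? (i ≟ j) ×-dec Vec.≡-dec Bool._≟_ (tail (F i)) (tail (F j))))
... | no ¬collision = inj₁ λ {i} {j} eq →
      decidable-stable (i ≟ j) λ i≢j → ¬collision (i , j , i≢j , eq)
... | yes (i , j , i≢j , eq) = inj₂ (i , doubled)
  where
  doubled : Doubled F (tail (F i))
  doubled b with tail-≡ (i≢j ∘ F-inj) eq b
  ... | inj₁ Fi = i , Fi
  ... | inj₂ Fj = j , Fj

remove : Fin (suc m) → (Fin (suc m) → Subset n) → Fin m → Subset n
remove i F = F ∘ punchIn i

remove-injective : ∀ i {F : Fin (suc m) → Subset n} → Injective _≡_ _≡_ F → Injective _≡_ _≡_ (remove i F)
remove-injective i F-inj = punchIn-injective i _ _ ∘ F-inj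

doubled-remove : ∀ i {F : Fin (suc m) → Subset (suc n)} → Doubled (remove i F) S → Doubled F S
doubled-remove i d b with j , eq ← d b = punchIn i j , eq

-- Otherwise one of the two extensions found among the remaining members would be `F i` itself,
-- against injectivity.
doubled-remove-≢ : ∀ i {F : Fin (suc m) → Subset (suc n)} → Injective _≡_ _≡_ F →
                   Doubled (remove i F) S → tail (F i) ≢ S
doubled-remove-≢ i {F} F-inj d eq with F i in Fi
... | b ∷ _ with j , Fj ← d b = punchInᵢ≢i i j (F-inj (trans Fj (trans (cong (b ∷_) (sym eq)) (sym Fi))))

head-injective : Injective _≡_ _≡_ (head {A = Bool} {n = 0})
head-injective {_ ∷ []} {_ ∷ []} refl = refl

fromBool : Bool → Fin 2
fromBool false = zero
fromBool true  = suc zero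

fromBool-injective : Injective _≡_ _≡_ fromBool
fromBool-injective {false} {false} _ = refl
fromBool-injective {true}  {true}  _ = refl

-- Induction deletes the element `zero`. At most two tails are doubled, the empty one and one
-- nonempty one, so dropping at most two members makes `tail` injective on the rest; each new
-- element costs two.
laminar-bound : ∀ n {m} (F : Fin m → Subset (suc n)) →
                Injective _≡_ _≡_ F → LaminarFamily F → m ≤ suc n ℕ.* 2
laminar-bound zero    F F-inj _   =
  -- A one-element set has two subsets, told apart by their head.
  injective⇒≤ {f = fromBool ∘ head ∘ F} (F-inj ∘ head-injective ∘ fromBool-injective)
laminar-bound (suc n) F F-inj lam = remove-two F F-inj lam
  where
  tails : ∀ {m} (F : Fin m → Subset (suc (suc n))) → Injective _≡_ _≡_ (tail ∘ F) → LaminarFamily F →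
          m ≤ suc n ℕ.* 2
  tails F tF-inj lam =
    laminar-bound n (tail ∘ F) tF-inj λ i j → tail-laminar (F i) (F j) (lam i j)

  remove-two : ∀ {m} (F : Fin m → Subset (suc (suc n))) → Injective _≡_ _≡_ F → LaminarFamily F →
               m ≤ suc (suc n) ℕ.* 2
  remove-two F F-inj lam with tail-injective⊎doubled F F-inj
  remove-two F F-inj lam | inj₁ tF-inj = ℕ.m≤n⇒m≤1+n (ℕ.m≤n⇒m≤1+n (tails F tF-inj lam))
  remove-two {suc m} F F-inj lam | inj₂ (i , dᵢ)
    with G-inj ← remove-injective i F-inj
    with tail-injective⊎doubled (remove i F) G-inj
  ... | inj₁ tG-inj = s≤s (ℕ.m≤n⇒m≤1+n (tails (remove i F) tG-inj (λ _ _ → lam _ _)))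
  remove-two {suc (suc m)} F F-inj lam | inj₂ (i , dᵢ) | inj₂ (j , dⱼ)
    with H-inj ← remove-injective j {remove i F} G-inj
    with tail-injective⊎doubled (remove j (remove i F)) H-inj
  ... | inj₁ tH-inj = s≤s (s≤s (tails (remove j (remove i F)) tH-inj (λ _ _ → lam _ _)))
  -- Collisions that survive removals are collisions of `F` as well, and each removal separates its
  -- tail from the later ones. This would give three distinct doubled tails.
  ... | inj₂ (l , dₗ) = ⊥-elim
    (doubled-≤2 lam dᵢ (doubled-remove i dⱼ) (doubled-remove i (doubled-remove j dₗ))
      (doubled-remove-≢ i F-inj dⱼ)
      (doubled-remove-≢ i F-inj (doubled-remove j dₗ))
      (doubled-remove-≢ j G-inj dₗ))

-- `⊥` and `⊤` can be added to the family without losing laminarity or injectivity, which improves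
-- the general bound by two.
proper-laminar-bound : ∀ n {m} (F : Fin m → Subset (suc n)) → Injective _≡_ _≡_ F → LaminarFamily F →
  (∀ i → Nonempty (F i)) → (∀ i → ∃ λ x → x ∉ F i) → m ≤ n ℕ.* 2
proper-laminar-bound n {m} F F-inj lam ne pr with laminar-bound n G G-inj G-lam
  where
  G : Fin (suc (suc m)) → Subset (suc n)
  G zero          = ⊥
  G (suc zero)    = ⊤
  G (suc (suc i)) = F i

  ⊥≢F : ∀ i → ⊥ ≢ F i
  ⊥≢F i eq with x , x∈ ← ne i = ∉⊥ (subst (x ∈_) (sym eq) x∈)

  ⊤≢F : ∀ i → ⊤ ≢ F i
  ⊤≢F i eq with x , x∉ ← pr i = x∉ (subst (x ∈_) eq ∈⊤)

  G-inj : Injective _≡_ _≡_ G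
  G-inj {zero}        {zero}        _  = refl
  G-inj {zero}        {suc zero}    ()
  G-inj {zero}        {suc (suc j)} eq = contradiction eq (⊥≢F j)
  G-inj {suc zero}    {zero}        ()
  G-inj {suc zero}    {suc zero}    _  = refl
  G-inj {suc zero}    {suc (suc j)} eq = contradiction eq (⊤≢F j)
  G-inj {suc (suc i)} {zero}        eq = contradiction (sym eq) (⊥≢F i)
  G-inj {suc (suc i)} {suc zero}    eq = contradiction (sym eq) (⊤≢F i)
  G-inj {suc (suc i)} {suc (suc j)} eq = cong suc (cong suc (F-inj eq))

  G-lam : LaminarFamily G
  G-lam zero          _             = inj₁ λ _ i∈⊥ _ → ∉⊥ i∈⊥
  G-lam (suc zero)    _             = inj₂ (inj₂ (⊆-max _))
  G-lam (suc (suc i)) zero          = inj₁ λ _ _ → ∉⊥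
  G-lam (suc (suc i)) (suc zero)    = inj₂ (inj₁ (⊆-max _))
  G-lam (suc (suc i)) (suc (suc j)) = lam i j
... | s≤s (s≤s m≤n*2) = m≤n*2

-- A laminar family that attains the bound

maxLaminar : ∀ n → Fin (n ℕ.* 2) → Subset (suc n)
-- On the ground set {0, ..., n} of `maxLaminar n` the members are {j} and {j+1, ..., n} for each j
-- < n.
maxLaminar (suc n) zero          = ⁅ zero ⁆
maxLaminar (suc n) (suc zero)    = outside ∷ ⊤
maxLaminar (suc n) (suc (suc i)) = outside ∷ maxLaminar n i

maxLaminar-nonempty : ∀ n i → Nonempty (maxLaminar n i)
maxLaminar-nonempty (suc n) zero          = zero , here
maxLaminar-nonempty (suc n) (suc zero)    = suc zero , there here
maxLaminar-nonempty (suc n) (suc (suc i)) with x , x∈ ← maxLaminar-nonempty n i = suc x , there x∈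

maxLaminar-proper : ∀ n i → ∃ λ x → x ∉ maxLaminar n i
maxLaminar-proper (suc n) zero          = suc zero , λ { (there ()) }
maxLaminar-proper (suc n) (suc zero)    = zero , λ ()
maxLaminar-proper (suc n) (suc (suc i)) = zero , λ ()

maxLaminar-injective : ∀ n → Injective _≡_ _≡_ (maxLaminar n)
maxLaminar-injective (suc n) {zero}        {zero}        _  = refl
maxLaminar-injective (suc n) {zero}        {suc zero}    ()
maxLaminar-injective (suc n) {zero}        {suc (suc _)} ()
maxLaminar-injective (suc n) {suc zero}    {zero}        ()
maxLaminar-injective (suc n) {suc zero}    {suc zero}    _  = refl
maxLaminar-injective (suc n) {suc zero}    {suc (suc j)} eq
  with x , x∉ ← maxLaminar-proper n j = contradiction (subst (x ∈_) (Vec.∷-injectiveʳ eq) ∈⊤) x∉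
maxLaminar-injective (suc n) {suc (suc _)} {zero}        ()
maxLaminar-injective (suc n) {suc (suc i)} {suc zero}    eq
  with x , x∉ ← maxLaminar-proper n i = contradiction (subst (x ∈_) (sym (Vec.∷-injectiveʳ eq)) ∈⊤) x∉
maxLaminar-injective (suc n) {suc (suc i)} {suc (suc j)} eq =
  cong suc (cong suc (maxLaminar-injective n (Vec.∷-injectiveʳ eq)))

⁅zero⁆-disjoint : {S : Subset n} → Disjoint ⁅ zero ⁆ (outside ∷ S)
⁅zero⁆-disjoint .zero here ()
⁅zero⁆-disjoint (suc i) (there i∈⊥) _ = ∉⊥ i∈⊥

maxLaminar-laminar : ∀ n → LaminarFamily (maxLaminar n)
maxLaminar-laminar (suc n) zero          zero          = inj₂ (inj₁ ⊆-refl)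
maxLaminar-laminar (suc n) zero          (suc zero)    = inj₁ ⁅zero⁆-disjoint
maxLaminar-laminar (suc n) zero          (suc (suc j)) = inj₁ ⁅zero⁆-disjoint
maxLaminar-laminar (suc n) (suc zero)    zero          = inj₁ (disjoint-sym ⁅zero⁆-disjoint)
maxLaminar-laminar (suc n) (suc zero)    (suc zero)    = inj₂ (inj₁ ⊆-refl)
maxLaminar-laminar (suc n) (suc zero)    (suc (suc j)) = inj₂ (inj₂ (s⊆s (⊆-max _)))
maxLaminar-laminar (suc n) (suc (suc i)) zero          = inj₁ (disjoint-sym ⁅zero⁆-disjoint)
maxLaminar-laminar (suc n) (suc (suc i)) (suc zero)    = inj₂ (inj₁ (s⊆s (⊆-max _)))
maxLaminar-laminar (suc n) (suc (suc i)) (suc (suc j)) with maxLaminar-laminar n i j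
... | inj₁ d          = inj₁ λ { (suc x) (there x∈) (there x∈′) → d x x∈ x∈′ }
... | inj₂ (inj₁ S⊆T) = inj₂ (inj₁ (s⊆s S⊆T))
... | inj₂ (inj₂ T⊆S) = inj₂ (inj₂ (s⊆s T⊆S))

-- Walks and their lengths

module WalkProperties {a k} (Adj : Fin k → Fin k → Set a) where
  open GraphNotions Adj

  private variable
    u v w : Fin k
    l l′ : ℕ

  _++_ : Walk u v l → Walk v w l′ → Walk u w (l ℕ.+ l′)
  []      ++ q = q
  (e ∷ p) ++ q = e ∷ (p ++ q)

  last-onWalk : (p : Walk u w l) → OnWalk w p
  last-onWalk []      = here []
  last-onWalk (e ∷ p) = there e (last-onWalk p)

  splitAt : {p : Walk u w l} → OnWalk v p → ∃₂ λ a b → Walk u v a × Walk v w b × l ≡ a ℕ.+ b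
  splitAt (here p)    = 0 , _ , [] , p , refl
  splitAt (there e o) with a , b , q , r , eq ← splitAt o = suc a , b , e ∷ q , r , cong suc eq

  1≤length : u ≢ v → Walk u v l → 1 ≤ l
  1≤length u≢v []      = contradiction refl u≢v
  1≤length u≢v (_ ∷ _) = s≤s z≤n

  2≤length : u ≢ v → ¬ Adj u v → Walk u v l → 2 ≤ l
  2≤length u≢v ¬uv []          = contradiction refl u≢v
  2≤length u≢v ¬uv (e ∷ [])    = contradiction e ¬uv
  2≤length u≢v ¬uv (_ ∷ _ ∷ _) = s≤s (s≤s z≤n)

  3≤length : u ≢ v → ¬ Adj u v → (∀ x → Adj u x → ¬ Adj x v) → Walk u v l → 3 ≤ l
  3≤length u≢v ¬uv ¬uxv []              = contradiction refl u≢v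
  3≤length u≢v ¬uv ¬uxv (e ∷ [])        = contradiction e ¬uv
  3≤length u≢v ¬uv ¬uxv (e ∷ f ∷ [])    = contradiction f (¬uxv _ e)
  3≤length u≢v ¬uv ¬uxv (_ ∷ _ ∷ _ ∷ _) = s≤s (s≤s (s≤s z≤n))

  -- The vertex `y` follows `v` on the shortest walk. A walk from `u` to `y` of length at most `a`
  -- could be continued along the rest of it and would reach `w` too early.
  onShortest⇒extension : v ≢ w → OnShortest u w v →
    ∃₂ λ y a → Walk u v a × Adj v y × (∀ l → Walk u y l → suc a ≤ l)
  onShortest⇒extension v≢w (l , p , shortest , o) with splitAt o
  ... | a , _ , _ , []              , _    = contradiction refl v≢w
  ... | a , _ , q , (_∷_ {v = y} {l = b} e r) , refl = y , a , q , e , λ l′ s →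
    ℕ.+-cancelʳ-≤ b (suc a) l′ (ℕ.≤-trans (ℕ.≤-reflexive (sym (ℕ.+-suc a b))) (shortest (l′ ℕ.+ b) (s ++ r)))

-- Distances and strong resolution in a disjointness graph

-- C v is the set of factors on which the vertex v is a proper ideal, so that adjacency means disjointness.
module DisjointnessGraph {a k n} (Adj : Fin k → Fin k → Set a) (C : Fin k → Subset (suc n))
  (nonempty : ∀ v → Nonempty (C v))
  (proper : ∀ v → ∃ λ i → i ∉ C v)
  (adj⇒disjoint : ∀ {u v} → Adj u v → Disjoint (C u) (C v))
  (disjoint⇒adj : ∀ {u v} → Disjoint (C u) (C v) → Adj u v)
  (twins : ∀ S → Nonempty S → (∃ λ i → i ∉ S) → ∃₂ λ u v → u ≢ v × C u ≡ S × C v ≡ S)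
  where
  open GraphNotions Adj
  open WalkProperties Adj

  private variable
    u v w : Fin k

  meet⇒¬adj : ∀ {i} → i ∈ C u → i ∈ C v → ¬ Adj u v
  meet⇒¬adj i∈u i∈v e = adj⇒disjoint e _ i∈u i∈v

  ⊆-adj : C u ⊆ C v → Adj v w → Adj u w
  ⊆-adj u⊆v e = disjoint⇒adj λ i i∈u → adj⇒disjoint e i (u⊆v i∈u)

  adj-sym : Adj u v → Adj v u
  adj-sym e = disjoint⇒adj (disjoint-sym (adj⇒disjoint e))

  ofType : ∀ S → Nonempty S → (∃ λ i → i ∉ S) → ∃ λ v → C v ≡ S
  ofType S ne pr with u , _ , _ , Cu , _ ← twins S ne pr = u , Cu

  opposite : ∀ v → ∃ λ x → C x ≡ ∁ (C v)
  opposite v with i , i∈ ← nonempty v | j , j∉ ← proper v =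
    ofType (∁ (C v)) (j , x∉p⇒x∈∁p j∉) (i , x∈p⇒x∉∁p i∈)

  opposite⇒adj : C w ≡ ∁ (C v) → Adj v w
  opposite⇒adj Cw = disjoint⇒adj λ i i∈v i∈w → x∈∁p⇒x∉p (subst (i ∈_) Cw i∈w) i∈v

  -- A vertex of type `⁅ i ⁆` serves; this type is proper because it omits any element of `C u`.
  commonNeighbour : ∀ {i} → i ∉ C u → i ∉ C v → ∃ λ x → Adj u x × Adj x v
  commonNeighbour {u} {v} {i} i∉u i∉v
    with j , j∈u ← nonempty u
    with x , Cx ← ofType ⁅ i ⁆ (i , x∈⁅x⁆ i) (j , λ j∈i → i∉u (subst (_∈ C u) (x∈⁅y⁆⇒x≡y i j∈i) j∈u)) =
    x , adj-sym (avoid i∉u) , avoid i∉v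
    where
    avoid : ∀ {w} → i ∉ C w → Adj x w
    avoid {w} i∉w = disjoint⇒adj λ y y∈x y∈w →
      i∉w (subst (_∈ C w) (x∈⁅y⁆⇒x≡y i (subst (y ∈_) Cx y∈x)) y∈w)

  -- The distance is 1 for disjoint types, 2 for types that meet without covering the ground set,
  -- and 3 for types that meet and cover it.
  shortestWalk : u ≢ v → ∃ λ l → Σ (Walk u v l) Shortest
  shortestWalk {u} {v} u≢v with disjoint⊎meet (C u) (C v)
  ... | inj₁ d = 1 , disjoint⇒adj d ∷ [] , λ _ → 1≤length u≢v
  ... | inj₂ (i , i∈u , i∈v) with ⊆⊎⊈ (∁ (C u)) (C v)
  ...   | inj₂ (j , j∈∁u , j∉v) with x , ux , xv ← commonNeighbour (x∈∁p⇒x∉p j∈∁u) j∉v =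
    2 , ux ∷ xv ∷ [] , λ _ → 2≤length u≢v (meet⇒¬adj i∈u i∈v)
  ...   | inj₁ ∁u⊆v with x , Cx ← opposite u | y , Cy ← opposite v =
    -- Covering means that the complements of `C u` and `C v` are disjoint, which gives the middle
    -- edge between `x` and `y`.
    3 , opposite⇒adj Cx ∷ ⊆-adj x⊆v (opposite⇒adj Cy) ∷ adj-sym (opposite⇒adj Cy) ∷ [] ,
    λ _ → 3≤length u≢v (meet⇒¬adj i∈u i∈v) noCommonNeighbour
    where
    x⊆v : C x ⊆ C v
    x⊆v = ∁u⊆v ∘ subst (_ ∈_) Cx

    noCommonNeighbour : ∀ z → Adj u z → ¬ Adj z v
    noCommonNeighbour z uz zv with j , j∈z ← nonempty z =
      adj⇒disjoint zv j j∈z (∁u⊆v (x∉p⇒x∈∁p λ j∈u → adj⇒disjoint uz j j∈u j∈z))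

  -- Equal types would make `y` a neighbour of `u`, no further away than `v`. If the types meet and
  -- `v` has an element outside `C u`, that element also avoids `C y`, so `u` and `y` have a common
  -- neighbour; but `v` is already at distance at least 2.
  extension⇒nested : ∀ {y l} → u ≢ v → Walk u v l → Adj v y → (∀ l′ → Walk u y l′ → suc l ≤ l′) →
                     C u ≢ C v × (Disjoint (C u) (C v) ⊎ C v ⊆ C u)
  extension⇒nested {u} {v} {y} u≢v p vy far = types-differ , nested
    where
    types-differ : C u ≢ C v
    types-differ eq with far 1 (⊆-adj (⊆-reflexive eq) vy ∷ []) | 1≤length u≢v p
    ... | s≤s z≤n | ()

    nested : Disjoint (C u) (C v) ⊎ C v ⊆ C u
    nested with disjoint⊎meet (C u) (C v) | ⊆⊎⊈ (C v) (C u)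
    ... | inj₁ d               | _        = inj₁ d
    ... | inj₂ _               | inj₁ v⊆u = inj₂ v⊆u
    ... | inj₂ (i , i∈u , i∈v) | inj₂ (j , j∈v , j∉u)
      with x , ux , xy ← commonNeighbour j∉u (adj⇒disjoint vy j j∈v)
      with s≤s (s≤s ()) ← ℕ.≤-trans (s≤s (2≤length u≢v (meet⇒¬adj i∈u i∈v) p)) (far 2 (ux ∷ xy ∷ []))

  onShortest⇒laminar : u ≢ v → v ≢ w → OnShortest u w v → C u ≢ C v × Laminar (C u) (C v)
  onShortest⇒laminar u≢v v≢w o
    with y , l , p , vy , far ← onShortest⇒extension v≢w o
    with extension⇒nested u≢v p vy far
  ... | Cu≢Cv , inj₁ d   = Cu≢Cv , inj₁ d
  ... | Cu≢Cv , inj₂ v⊆u = Cu≢Cv , inj₂ (inj₂ v⊆u)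

  stronglyResolves⇒laminar : u ≢ v → u ≢ w → v ≢ w → StronglyResolves w u v →
                             C u ≢ C v × Laminar (C u) (C v)
  stronglyResolves⇒laminar u≢v u≢w v≢w (inj₁ o) = onShortest⇒laminar u≢v v≢w o
  stronglyResolves⇒laminar u≢v u≢w v≢w (inj₂ o)
    with Cv≢Cu , lam ← onShortest⇒laminar (u≢v ∘ sym) u≢w o = Cv≢Cu ∘ sym , laminar-sym lam

  -- The complement of a strong resolving set

  module _ {W : Subset k} (resolving : StrongResolvingSet W) where

    private
      outside-laminar : ∀ {u v} → u ∉ W → v ∉ W → u ≢ v → C u ≢ C v × Laminar (C u) (C v)
      outside-laminar u∉W v∉W u≢v with w , w∈W , r ← resolving _ _ u≢v =
        stronglyResolves⇒laminar u≢v (λ { refl → u∉W w∈W }) (λ { refl → v∉W w∈W }) r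

      F : Fin ∣ ∁ W ∣ → Subset (suc n)
      F = C ∘ enum (∁ W)

      enum∉W : ∀ i → enum (∁ W) i ∉ W
      enum∉W i = x∈∁p⇒x∉p (enum-∈ (∁ W) i)

      F-injective : Injective _≡_ _≡_ F
      F-injective {i} {j} eq = decidable-stable (i ≟ j) λ i≢j →
        proj₁ (outside-laminar (enum∉W i) (enum∉W j) (i≢j ∘ enum-injective (∁ W))) eq

      F-laminar : LaminarFamily F
      F-laminar i j with i ≟ j
      ... | yes refl = inj₂ (inj₁ ⊆-refl)
      ... | no  i≢j  = proj₂ (outside-laminar (enum∉W i) (enum∉W j) (i≢j ∘ enum-injective (∁ W)))

    -- A resolver in `W` differs from both vertices of a pair outside `W`, so the types outside `W`
    -- are pairwise distinct and laminar.
    ∣∁resolving∣≤ : ∣ ∁ W ∣ ≤ n ℕ.* 2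
    ∣∁resolving∣≤ = proper-laminar-bound n F F-injective F-laminar (λ _ → nonempty _) (λ _ → proper _)

  -- Laminar sets have strongly resolving complements

  module _ {D : Subset k} (C-injective : ∀ {u v} → u ∈ D → v ∈ D → C u ≡ C v → u ≡ v)
    (laminar : ∀ {u v} → u ∈ D → v ∈ D → Laminar (C u) (C v)) where

    private
      -- At most one of two twins lies in `D`, so resolvers of every type are available outside `D`.
      twinOutside : ∀ S → Nonempty S → (∃ λ i → i ∉ S) → ∃ λ w → w ∉ D × C w ≡ S
      twinOutside S ne pr with u , v , u≢v , Cu , Cv ← twins S ne pr with u ∈? D | v ∈? D
      ... | no  u∉D | _       = u , u∉D , Cu
      ... | yes _   | no  v∉D = v , v∉D , Cv
      ... | yes u∈D | yes v∈D = contradiction (C-injective u∈D v∈D (trans Cu (sym Cv))) u≢v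

      -- The resolver is a twin `w` of `u`: their common type is nonempty, so they are not adjacent,
      -- and `v` is a common neighbour.
      resolve-disjoint : u ∈ D → Disjoint (C u) (C v) → ∃ λ w → w ∉ D × OnShortest u w v
      resolve-disjoint {u} {v} u∈D d
        with i , i∈u ← nonempty u
        with w , w∉D , Cw ← twinOutside (C u) (nonempty u) (proper u) =
        w , w∉D , 2 ,
        disjoint⇒adj d ∷ adj-sym (⊆-adj (⊆-reflexive Cw) (disjoint⇒adj d)) ∷ [] ,
        (λ _ → 2≤length (λ { refl → w∉D u∈D }) (meet⇒¬adj i∈u (subst (i ∈_) (sym Cw) i∈u))) ,
        there _ (here _)

      -- The resolver `w` has type `∁ (C u)`. The types of `v` and `w` cover the ground set and meet
      -- at `j`, so their distance is 3, attained by a walk that passes from `v` to a vertex of type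
      -- `∁ (C v)`, then to `u`, then to `w`.
      resolve-⊆ : u ∈ D → v ∈ D → u ≢ v → C u ⊆ C v → ∃ λ w → w ∉ D × OnShortest v w u
      resolve-⊆ {u} {v} u∈D v∈D u≢v u⊆v with ⊆⊎⊈ (C v) (C u)
      ... | inj₁ v⊆u = contradiction (C-injective u∈D v∈D (⊆-antisym u⊆v v⊆u)) u≢v
      ... | inj₂ (j , j∈v , j∉u)
        with i , i∈u ← nonempty u
        with w , w∉D , Cw ← twinOutside (∁ (C u)) (j , x∉p⇒x∈∁p j∉u) (i , x∈p⇒x∉∁p i∈u)
           | x , Cx ← opposite v =
        w , w∉D , 3 ,
        opposite⇒adj Cx ∷ adj-sym (⊆-adj u⊆v (opposite⇒adj Cx)) ∷ opposite⇒adj Cw ∷ [] ,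
        (λ _ → 3≤length (λ { refl → i∉w (u⊆v i∈u) }) (meet⇒¬adj j∈v (∉u⇒∈w j∉u)) noCommonNeighbour) ,
        there _ (there _ (here _))
        where
        i∉w : i ∉ C w
        i∉w i∈w = x∈∁p⇒x∉p (subst (i ∈_) Cw i∈w) i∈u

        ∉u⇒∈w : ∀ {y} → y ∉ C u → y ∈ C w
        ∉u⇒∈w y∉u = subst (_ ∈_) (sym Cw) (x∉p⇒x∈∁p y∉u)

        noCommonNeighbour : ∀ z → Adj v z → ¬ Adj z w
        noCommonNeighbour z vz zw with y , y∈z ← nonempty z =
          adj⇒disjoint zw y y∈z (∉u⇒∈w λ y∈u → adj⇒disjoint vz y (u⊆v y∈u) y∈z)

    ∁-resolving : StrongResolvingSet (∁ D)
    ∁-resolving u v u≢v with u ∈? D | v ∈? D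
    -- A vertex outside `D` resolves each pair it belongs to, being an end of a shortest walk
    -- between the two.
    ... | no u∉D | _ with l , p , shortest ← shortestWalk (u≢v ∘ sym) =
      u , x∉p⇒x∈∁p u∉D , inj₂ (l , p , shortest , last-onWalk p)
    ... | yes _ | no v∉D with l , p , shortest ← shortestWalk u≢v =
      v , x∉p⇒x∈∁p v∉D , inj₁ (l , p , shortest , last-onWalk p)
    ... | yes u∈D | yes v∈D with laminar u∈D v∈D
    ...   | inj₁ d with w , w∉D , o ← resolve-disjoint u∈D d = w , x∉p⇒x∈∁p w∉D , inj₁ o
    ...   | inj₂ (inj₁ u⊆v) with w , w∉D , o ← resolve-⊆ u∈D v∈D u≢v u⊆v = w , x∉p⇒x∈∁p w∉D , inj₂ o
    ...   | inj₂ (inj₂ v⊆u) with w , w∉D , o ← resolve-⊆ v∈D u∈D (u≢v ∘ sym) v⊆u = w , x∉p⇒x∈∁p w∉D , inj₁ o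

  -- `D` takes one vertex of each type in `maxLaminar n`. No resolving set has a complement larger
  -- than `D`, so `∁ D` is a smallest one. The additive equation avoids truncated subtraction.
  sdim : ∃ λ s → s ℕ.+ n ℕ.* 2 ≡ k × HasSdim s
  sdim = ∣ ∁ D ∣ , ∣∁D∣+n*2≡k , (∁ D , ∁-resolving D-injective D-laminar , refl) , minimal
    where
    chosen : ∀ i → ∃ λ v → C v ≡ maxLaminar n i
    chosen i = ofType (maxLaminar n i) (maxLaminar-nonempty n i) (maxLaminar-proper n i)

    g : Fin (n ℕ.* 2) → Fin k
    g = proj₁ ∘ chosen

    C-g : ∀ i → C (g i) ≡ maxLaminar n i
    C-g = proj₂ ∘ chosen

    C∘g-injective : ∀ {i j} → C (g i) ≡ C (g j) → i ≡ j
    C∘g-injective eq = maxLaminar-injective n (trans (sym (C-g _)) (trans eq (C-g _)))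

    image? : ∀ v → Dec (∃ λ i → g i ≡ v)
    image? v = any? λ i → g i ≟ v

    D : Subset k
    D = select image?

    D-injective : u ∈ D → v ∈ D → C u ≡ C v → u ≡ v
    D-injective u∈D v∈D eq with ∈-select⁻ image? u∈D | ∈-select⁻ image? v∈D
    ... | _ , refl | _ , refl = cong g (C∘g-injective eq)

    D-laminar : u ∈ D → v ∈ D → Laminar (C u) (C v)
    D-laminar u∈D v∈D with ∈-select⁻ image? u∈D | ∈-select⁻ image? v∈D
    ... | i , refl | j , refl =
      subst (λ S → Laminar S _) (sym (C-g i)) (subst (Laminar _) (sym (C-g j)) (maxLaminar-laminar n i j))

    preimage : ∀ i → ∃ λ j → g j ≡ enum D i
    preimage i = ∈-select⁻ image? (enum-∈ D i)

    ∣D∣≡n*2 : ∣ D ∣ ≡ n ℕ.* 2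
    ∣D∣≡n*2 = ℕ.≤-antisym
      (injective⇒≤ {f = proj₁ ∘ preimage} λ {i} {j} eq →
        enum-injective D (trans (sym (proj₂ (preimage i))) (trans (cong g eq) (proj₂ (preimage j)))))
      (injective⇒≤∣∣ (C∘g-injective ∘ cong C) λ i → ∈-select⁺ image? (i , refl))

    ∣∁D∣+n*2≡k : ∣ ∁ D ∣ ℕ.+ n ℕ.* 2 ≡ k
    ∣∁D∣+n*2≡k = trans (cong (∣ ∁ D ∣ ℕ.+_) (sym ∣D∣≡n*2)) (∣∁p∣+∣p∣≡n D)

    minimal : ∀ W → StrongResolvingSet W → ∣ ∁ D ∣ ≤ ∣ W ∣
    minimal W resolving = ℕ.+-cancelʳ-≤ (n ℕ.* 2) _ _ (begin
      ∣ ∁ D ∣ ℕ.+ n ℕ.* 2    ≡⟨ ∣∁D∣+n*2≡k ⟩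
      k                  ≡⟨ ∣∁p∣+∣p∣≡n W ⟨
      ∣ ∁ W ∣ ℕ.+ ∣ W ∣    ≤⟨ ℕ.+-monoˡ-≤ ∣ W ∣ (∣∁resolving∣≤ resolving) ⟩
      n ℕ.* 2 ℕ.+ ∣ W ∣      ≡⟨ ℕ.+-comm (n ℕ.* 2) ∣ W ∣ ⟩
      ∣ W ∣ ℕ.+ n ℕ.* 2      ∎)
      where open ℕ.≤-Reasoning

-- Identities in a commutative ring

module RingIdentities {c ℓ} (A : CommutativeRing c ℓ) where
  open CommutativeRing A hiding (zero; refl; sym) renaming (trans to ≈-trans)
  open ≈-Reasoning setoid

  x+[1-x]≈1 : ∀ x → x + (1# - x) ≈ 1#
  x+[1-x]≈1 x = begin
    x + (1# - x)   ≈⟨ +-congˡ (+-comm 1# (- x)) ⟩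
    x + (- x + 1#) ≈⟨ +-assoc x (- x) 1# ⟨
    (x - x) + 1#   ≈⟨ +-congʳ (-‿inverseʳ x) ⟩
    0# + 1#        ≈⟨ +-identityˡ 1# ⟩
    1#             ∎

  x≈1⇒1-x≈0 : ∀ {x} → x ≈ 1# → 1# - x ≈ 0#
  x≈1⇒1-x≈0 x≈1 = ≈-trans (+-congˡ (-‿cong x≈1)) (-‿inverseʳ 1#)

  x+[1-x]y≈1ˡ : ∀ {x} y → x ≈ 1# → x + (1# - x) * y ≈ 1#
  x+[1-x]y≈1ˡ {x} y x≈1 = begin
    x + (1# - x) * y ≈⟨ +-cong x≈1 (*-congʳ (x≈1⇒1-x≈0 x≈1)) ⟩
    1# + 0# * y      ≈⟨ +-congˡ (zeroˡ y) ⟩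
    1# + 0#          ≈⟨ +-identityʳ 1# ⟩
    1#               ∎

  x+[1-x]y≈1ʳ : ∀ x {y} → y ≈ 1# → x + (1# - x) * y ≈ 1#
  x+[1-x]y≈1ʳ x {y} y≈1 = begin
    x + (1# - x) * y  ≈⟨ +-congˡ (*-congˡ y≈1) ⟩
    x + (1# - x) * 1# ≈⟨ +-congˡ (*-identityʳ _) ⟩
    x + (1# - x)      ≈⟨ x+[1-x]≈1 x ⟩
    1#                ∎

  zeroDivisor-nonunit : ∀ {r x} → ¬ r ≈ 0# → r * x ≈ 0# → ∀ u → ¬ u * x ≈ 1#
  zeroDivisor-nonunit {r} {x} r≉0 rx≈0 u ux≈1 = r≉0 (begin
    r            ≈⟨ *-identityʳ r ⟨
    r * 1#       ≈⟨ *-congˡ ux≈1 ⟨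
    r * (u * x)  ≈⟨ *-congˡ (*-comm u x) ⟩
    r * (x * u)  ≈⟨ *-assoc r x u ⟨
    (r * x) * u  ≈⟨ *-congʳ rx≈0 ⟩
    0# * u       ≈⟨ zeroˡ u ⟩
    0#           ∎)

  x≈x+x⇒x≈0 : ∀ {x} → x ≈ x + x → x ≈ 0#
  x≈x+x⇒x≈0 {x} x≈x+x = begin
    x             ≈⟨ +-identityʳ x ⟨
    x + 0#        ≈⟨ +-congˡ (-‿inverseʳ x) ⟨
    x + (x - x)   ≈⟨ +-assoc x x (- x) ⟨
    (x + x) - x   ≈⟨ +-congʳ x≈x+x ⟨
    x - x         ≈⟨ -‿inverseʳ x ⟩
    0#            ∎

-- Constructions of ideals and existence of maximal ideals

module IdealProperties {c ℓ} (A : CommutativeRing c ℓ) where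
  open CommutativeRing A hiding (zero) renaming (refl to ≈-refl; sym to ≈-sym; trans to ≈-trans)
  open RingNotions A

  zeroIdeal : Ideal
  zeroIdeal = record
    { mem  = λ x → Level.Lift c (x ≈ 0#)
    ; resp = λ { x≈y (lift x≈0) → lift (≈-trans (≈-sym x≈y) x≈0) }
    ; has0 = lift ≈-refl
    ; add  = λ { (lift x≈0) (lift y≈0) → lift (≈-trans (+-cong x≈0 y≈0) (+-identityˡ 0#)) }
    ; mulˡ = λ { r (lift x≈0) → lift (≈-trans (*-congˡ x≈0) (zeroʳ r)) }
    }

  principal : Carrier → Ideal
  principal w = record
    { mem  = λ x → ∃ λ u → Level.Lift c (u * w ≈ x)
    ; resp = λ { x≈y (u , lift uw≈x) → u , lift (≈-trans uw≈x x≈y) }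
    ; has0 = 0# , lift (zeroˡ w)
    ; add  = λ { (u , lift uw≈x) (v , lift vw≈y) →
                 u + v , lift (≈-trans (distribʳ w u v) (+-cong uw≈x vw≈y)) }
    ; mulˡ = λ { r (u , lift uw≈x) → r * u , lift (≈-trans (*-assoc r u w) (*-congˡ uw≈x)) }
    }

  colon : Ideal → Carrier → Ideal
  colon I w = record
    { mem  = λ x → mem I (w * x)
    ; resp = λ x≈y → resp I (*-congˡ x≈y)
    ; has0 = resp I (≈-sym (zeroʳ w)) (has0 I)
    ; add  = λ {x} {y} wx∈I wy∈I → resp I (≈-sym (distribˡ w x y)) (add I wx∈I wy∈I)
    ; mulˡ = λ r {x} wx∈I → resp I (begin
        r * (w * x)  ≈⟨ *-assoc r w x ⟨
        (r * w) * x  ≈⟨ *-congʳ (*-comm r w) ⟩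
        (w * r) * x  ≈⟨ *-assoc w r x ⟩
        w * (r * x)  ∎) (mulˡ I r wx∈I)
    }
    where open ≈-Reasoning setoid

  -- Encodes a proposition as an ideal: it is `I` when `P` fails and the whole ring when `P` holds.
  adjoin : Ideal → Set (c ⊔ ℓ) → Ideal
  adjoin I P = record
    { mem  = λ x → mem I x ⊎ P
    ; resp = λ { x≈y (inj₁ x∈I) → inj₁ (resp I x≈y x∈I) ; _ (inj₂ p) → inj₂ p }
    ; has0 = inj₁ (has0 I)
    ; add  = λ { (inj₁ x∈I) (inj₁ y∈I) → inj₁ (add I x∈I y∈I)
               ; (inj₂ p) _ → inj₂ p
               ; _ (inj₂ p) → inj₂ p }
    ; mulˡ = λ { r (inj₁ x∈I) → inj₁ (mulˡ I r x∈I) ; _ (inj₂ p) → inj₂ p }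
    }

  -- The notion of maximality in use decides propositions: M + {x | P} is either contained in M or contains 1.
  maximal⇒em : ∀ {M} → Maximal M → (P : Set (c ⊔ ℓ)) → Dec P
  maximal⇒em {M} (proper , maximal) P with maximal (adjoin M P) (λ _ → inj₁)
  ... | inj₁ ⊆M         = no λ p → proper (⊆M 1# (inj₂ p))
  ... | inj₂ (inj₁ 1∈M) = contradiction 1∈M proper
  ... | inj₂ (inj₂ p)   = yes p

  module _ (em : (P : Set (c ⊔ ℓ)) → Dec P) where

    -- One greedy pass moves up to each listed proper ideal that contains the current one. A skipped
    -- entry does not matter later: if proper, it fails to contain the current ideal and hence
    -- anything larger.
    saturate : ∀ {m} (Is : Fin m → Ideal) I → Proper I →
      ∃ λ N → Proper N × I ⊆I N × (∀ t → N ⊆I Is t → Proper (Is t) → Is t ⊆I N)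
    saturate {zero}  Is I pr = I , pr , (λ _ → id) , λ ()
    saturate {suc m} Is I pr with em (I ⊆I Is zero × Proper (Is zero))
    ... | yes (I⊆ , pr₀) with N , prN , ⊆N , sat ← saturate (Is ∘ suc) (Is zero) pr₀ =
      N , prN , (λ x → ⊆N x ∘ I⊆ x) , λ { zero _ _ → ⊆N ; (suc t) → sat t }
    ... | no ¬p with N , prN , ⊆N , sat ← saturate (Is ∘ suc) I pr =
      N , prN , ⊆N , λ { zero N⊆ pr₀ → contradiction ((λ x → N⊆ x ∘ ⊆N x) , pr₀) ¬p ; (suc t) → sat t }

    -- The finite list of ideals takes the place of Zorn's lemma: a proper ideal above `N` equals a
    -- listed one, which lies in `N` by saturation.
    extendToMaximal : FinitelyManyIdeals → ∀ I → Proper I → ∃ λ N → Maximal N × I ⊆I N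
    extendToMaximal (m , Is , complete) I pr with N , prN , I⊆N , sat ← saturate Is I pr =
      N , (prN , maximal) , I⊆N
      where
      maximal : ∀ J → N ⊆I J → J ⊆I N ⊎ mem J 1#
      maximal J N⊆J with em (mem J 1#) | complete J
      ... | yes 1∈J | _               = inj₂ 1∈J
      ... | no  1∉J | t , J⊆Is , Is⊆J = inj₁ λ x x∈J →
        sat t (λ y → J⊆Is y ∘ N⊆J y) (1∉J ∘ Is⊆J 1#) x (J⊆Is x x∈J)

-- Ideals and maximal ideals of a finite product of local rings

module ProductOfLocalRings {c ℓ} (R : CommutativeRing c ℓ)
  {n} (Rs : Fin (suc n) → CommutativeRing c ℓ)
  (finite : RingNotions.FinitelyManyIdeals R) (iso : IsoToProduct R (suc n) Rs)
  (local : ∀ i → RingNotions.Local (Rs i)) where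

  open CommutativeRing R hiding (zero) renaming (refl to ≈-refl; sym to ≈-sym; trans to ≈-trans)
  open RingNotions R
  open IdealProperties R
  private
    module A {i} = CommutativeRing (Rs i)
    module I {i} = RingNotions (Rs i)
    module Id {i} = RingIdentities (Rs i)

  φ : Carrier → ∀ i → A.Carrier {i}
  φ = proj₁ iso

  φ-cong : ∀ {x y} i → x ≈ y → φ x i A.≈ φ y i
  φ-cong = proj₁ (proj₂ iso)

  φ-+ : ∀ x y i → φ (x + y) i A.≈ φ x i A.+ φ y i
  φ-+ = proj₁ (proj₂ (proj₂ iso))

  φ-* : ∀ x y i → φ (x * y) i A.≈ φ x i A.* φ y i
  φ-* = proj₁ (proj₂ (proj₂ (proj₂ iso)))

  φ-1 : ∀ i → φ 1# i A.≈ A.1#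
  φ-1 = proj₁ (proj₂ (proj₂ (proj₂ (proj₂ iso))))

  φ-injective : ∀ x y → (∀ i → φ x i A.≈ φ y i) → x ≈ y
  φ-injective = proj₁ (proj₂ (proj₂ (proj₂ (proj₂ (proj₂ iso)))))

  φ-surjective : (f : ∀ i → A.Carrier {i}) → ∃ λ x → ∀ i → φ x i A.≈ f i
  φ-surjective = proj₂ (proj₂ (proj₂ (proj₂ (proj₂ (proj₂ iso)))))

  φ-0 : ∀ i → φ 0# i A.≈ A.0#
  φ-0 i = Id.x≈x+x⇒x≈0 (A.trans (φ-cong i (≈-sym (+-identityˡ 0#))) (φ-+ 0# 0# i))

  φ≈1⇒≈1 : ∀ {x} → (∀ i → φ x i A.≈ A.1#) → x ≈ 1#
  φ≈1⇒≈1 φx≈1 = φ-injective _ _ λ i → A.trans (φx≈1 i) (A.sym (φ-1 i))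

  φ≈0⇒≈0 : ∀ {x} → (∀ i → φ x i A.≈ A.0#) → x ≈ 0#
  φ≈0⇒≈0 φx≈0 = φ-injective _ _ λ i → A.trans (φx≈0 i) (A.sym (φ-0 i))

  -- Chosen by surjectivity, so that its components are known without asking how `φ` treats
  -- negation.
  complement : Carrier → Carrier
  complement x = proj₁ (φ-surjective λ i → A.1# A.- φ x i)

  φ-complement : ∀ x i → φ (complement x) i A.≈ A.1# A.- φ x i
  φ-complement x = proj₂ (φ-surjective _)

  x+complement≈1 : ∀ x → x + complement x ≈ 1#
  x+complement≈1 x = φ≈1⇒≈1 λ i →
    A.trans (φ-+ x _ i) (A.trans (A.+-congˡ (φ-complement x i)) (Id.x+[1-x]≈1 (φ x i)))

  φ≈1⇒φ-complement≈0 : ∀ {x i} → φ x i A.≈ A.1# → φ (complement x) i A.≈ A.0#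
  φ≈1⇒φ-complement≈0 {x} {i} φx≈1 = A.trans (φ-complement x i) (Id.x≈1⇒1-x≈0 φx≈1)

  -- This is 1 - (1 - x)(1 - y), with component 1 wherever `x` or `y` has component 1.
  _∨_ : Carrier → Carrier → Carrier
  x ∨ y = x + complement x * y

  φ-∨ : ∀ x y i → φ (x ∨ y) i A.≈ φ x i A.+ (A.1# A.- φ x i) A.* φ y i
  φ-∨ x y i = A.trans (φ-+ x _ i) (A.+-congˡ (A.trans (φ-* _ y i) (A.*-congʳ (φ-complement x i))))

  φ-∨≈1ˡ : ∀ {x y i} → φ x i A.≈ A.1# → φ (x ∨ y) i A.≈ A.1#
  φ-∨≈1ˡ φx≈1 = A.trans (φ-∨ _ _ _) (Id.x+[1-x]y≈1ˡ _ φx≈1)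

  φ-∨≈1ʳ : ∀ {x y i} → φ y i A.≈ A.1# → φ (x ∨ y) i A.≈ A.1#
  φ-∨≈1ʳ φy≈1 = A.trans (φ-∨ _ _ _) (Id.x+[1-x]y≈1ʳ _ φy≈1)

  extendByZero : ∀ i → A.Carrier {i} → ∀ j → A.Carrier {j}
  extendByZero i y j with i ≟ j
  ... | yes refl = y
  ... | no  _    = A.0#

  extendByZero-≡ : ∀ i y → extendByZero i y i ≡ y
  extendByZero-≡ i y with i ≟ i
  ... | yes refl = refl
  ... | no  i≢i  = contradiction refl i≢i

  extendByZero-≢ : ∀ {i j} → i ≢ j → ∀ y → extendByZero i y j ≡ A.0#
  extendByZero-≢ {i} {j} i≢j y with i ≟ j
  ... | yes i≡j = contradiction i≡j i≢j
  ... | no  _   = refl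

  ι : ∀ i → A.Carrier {i} → Carrier
  ι i y = proj₁ (φ-surjective (extendByZero i y))

  φ-ι-≡ : ∀ i y → φ (ι i y) i A.≈ y
  φ-ι-≡ i y = A.trans (proj₂ (φ-surjective _) i) (A.reflexive (extendByZero-≡ i y))

  φ-ι-≢ : ∀ {i j} → i ≢ j → ∀ y → φ (ι i y) j A.≈ A.0#
  φ-ι-≢ {j = j} i≢j y = A.trans (proj₂ (φ-surjective _) j) (A.reflexive (extendByZero-≢ i≢j y))

  -- The idempotent of a factor: `mem J (e i)` says that `J` fills the `i`-th factor.
  e : Fin (suc n) → Carrier
  e i = ι i A.1#

  em : (P : Set (c ⊔ ℓ)) → Dec P
  em = IdealProperties.maximal⇒em (Rs zero) {proj₁ (local zero)} (proj₁ (proj₂ (local zero)))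

  pullback : ∀ {i} → I.Ideal {i} → Ideal
  pullback {i} J = record
    { mem  = λ x → I.mem J (φ x i)
    ; resp = λ x≈y → I.resp J (φ-cong i x≈y)
    ; has0 = I.resp J (A.sym (φ-0 i)) (I.has0 J)
    ; add  = λ x∈ y∈ → I.resp J (A.sym (φ-+ _ _ i)) (I.add J x∈ y∈)
    ; mulˡ = λ r x∈ → I.resp J (A.sym (φ-* r _ i)) (I.mulˡ J (φ r i) x∈)
    }

  image : ∀ i → Ideal → I.Ideal {i}
  image i N = record
    { mem  = λ y → ∃ λ x → mem N x × φ x i A.≈ y
    ; resp = λ { y≈z (x , x∈N , φx≈y) → x , x∈N , A.trans φx≈y y≈z }
    ; has0 = 0# , has0 N , φ-0 i
    ; add  = λ { (x , x∈N , φx≈y) (x′ , x′∈N , φx′≈y′) →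
                 x + x′ , add N x∈N x′∈N , A.trans (φ-+ x x′ i) (A.+-cong φx≈y φx′≈y′) }
    ; mulˡ = λ { r (x , x∈N , φx≈y) →
                 ι i r * x , mulˡ N (ι i r) x∈N ,
                 A.trans (φ-* _ x i) (A.*-cong (φ-ι-≡ i r) φx≈y) }
    }

  𝔪 : ∀ i → I.Ideal {i}
  𝔪 i = proj₁ (local i)

  𝔪-proper : ∀ i → I.Proper (𝔪 i)
  𝔪-proper i = proj₁ (proj₁ (proj₂ (local i)))

  M : Fin (suc n) → Ideal
  M i = pullback (𝔪 i)

  φ≈1⇒∉M : ∀ {x i} → φ x i A.≈ A.1# → ¬ mem (M i) x
  φ≈1⇒∉M {i = i} φx≈1 x∈M = 𝔪-proper i (I.resp (𝔪 i) φx≈1 x∈M)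

  e∉M : ∀ i → ¬ mem (M i) (e i)
  e∉M i = φ≈1⇒∉M (φ-ι-≡ i A.1#)

  M-proper : ∀ i → Proper (M i)
  M-proper i = φ≈1⇒∉M (φ-1 i)

  eᵢx≈0 : ∀ {x i} → φ x i A.≈ A.0# → e i * x ≈ 0#
  eᵢx≈0 {x} {i} φx≈0 = φ≈0⇒≈0 λ j → A.trans (φ-* (e i) x j) (vanish j)
    where
    vanish : ∀ j → φ (e i) j A.* φ x j A.≈ A.0#
    vanish j with i ≟ j
    ... | yes refl = A.trans (A.*-congˡ φx≈0) (A.zeroʳ _)
    ... | no  i≢j  = A.trans (A.*-congʳ (φ-ι-≢ i≢j A.1#)) (A.zeroˡ _)

  -- The correspondence of ideals under the `i`-th projection. If `x` in `N` projects to 1, then 1 -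
  -- x has component 0 and lies in `N` too, so `N` would contain 1.
  image-maximal : ∀ {i N} → Maximal N → (∀ x → φ x i A.≈ A.0# → mem N x) → I.Maximal (image i N)
  image-maximal {i} {N} (N-proper , N-maximal) ker⊆N = proper , maximal
    where
    proper : I.Proper (image i N)
    proper (x , x∈N , φx≈1) =
      N-proper (resp N (x+complement≈1 x) (add N x∈N (ker⊆N _ (φ≈1⇒φ-complement≈0 φx≈1))))

    maximal : ∀ J → image i N I.⊆I J → J I.⊆I image i N ⊎ I.mem J A.1#
    maximal J N⊆J with N-maximal (pullback J) (λ x x∈N → N⊆J _ (x , x∈N , A.refl))
    ... | inj₁ J⊆N = inj₁ λ y y∈J →
      ι i y , J⊆N _ (I.resp J (A.sym (φ-ι-≡ i y)) y∈J) , φ-ι-≡ i y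
    ... | inj₂ 1∈J = inj₂ (I.resp J (φ-1 i) 1∈J)

  -- {x | eᵢ x ∈ J} is proper and contains the kernel of the i-th projection.  A maximal ideal above it
  -- therefore projects onto a maximal ideal of Rᵢ, which is 𝔪 i.
  e∉⇒⊆M : ∀ {i} J → ¬ mem J (e i) → J ⊆I M i
  e∉⇒⊆M {i} J e∉J
    with N , N-max , colon⊆N ← extendToMaximal em finite (colon J (e i)) (e∉J ∘ resp J (*-identityʳ (e i)))
    with N⊆m , _ ← proj₂ (proj₂ (local i)) (image i N)
                     (image-maximal {N = N} N-max λ x φx≈0 → colon⊆N x (resp J (≈-sym (eᵢx≈0 φx≈0)) (has0 J))) =
    λ x x∈J → N⊆m _ (x , colon⊆N x (mulˡ J (e i) x∈J) , A.refl)

  -- An ideal above `M i` that contains `e i` also contains 1 - e i, whose `i`-th component is 0;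
  -- one that omits `e i` stays inside `M i`.
  M-maximal : ∀ i → Maximal (M i)
  M-maximal i = M-proper i , maximal
    where
    maximal : ∀ J → M i ⊆I J → J ⊆I M i ⊎ mem J 1#
    maximal J M⊆J with em (mem J (e i))
    ... | no  e∉J = inj₁ (e∉⇒⊆M J e∉J)
    ... | yes e∈J = inj₂ (resp J (x+complement≈1 (e i)) (add J e∈J (M⊆J _
      (I.resp (𝔪 i) (A.sym (φ≈1⇒φ-complement≈0 (φ-ι-≡ i A.1#))) (I.has0 (𝔪 i))))))

  -- The element is the join of those `e (f t)` that lie in `J`. The list `f` of factors is there
  -- for the recursion; uses take all factors.
  unitOn : ∀ J {k} (f : Fin k → Fin (suc n)) →
           ∃ λ a → mem J a × (∀ t → mem J (e (f t)) → φ a (f t) A.≈ A.1#)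
  unitOn J {zero}  f = 0# , has0 J , λ ()
  unitOn J {suc k} f with unitOn J (f ∘ suc) | em (mem J (e (f zero)))
  ... | a , a∈J , φa≈1 | no  e∉J = a , a∈J , λ { zero e∈J → contradiction e∈J e∉J ; (suc t) → φa≈1 t }
  ... | a , a∈J , φa≈1 | yes e∈J = e (f zero) ∨ a , add J e∈J (mulˡ J _ a∈J) ,
    λ { zero _ → φ-∨≈1ˡ (φ-ι-≡ _ A.1#) ; (suc t) e∈J → φ-∨≈1ʳ (φa≈1 t e∈J) }

  cover⇒comaximal : ∀ J K → (∀ i → mem J (e i) ⊎ mem K (e i)) → Comaximal J K
  cover⇒comaximal J K cover
    with a , a∈J , φa≈1 ← unitOn J id | b , b∈K , φb≈1 ← unitOn K id =
    a , complement a * b , a∈J , mulˡ K _ b∈K ,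
    φ≈1⇒≈1 λ i → [ (λ e∈J → φ-∨≈1ˡ (φa≈1 i e∈J)) , (λ e∈K → φ-∨≈1ʳ (φb≈1 i e∈K)) ]′ (cover i)

  proper⇒e∉ : ∀ {J} → Proper J → ∃ λ i → ¬ mem J (e i)
  proper⇒e∉ {J} pr = ¬∀⟶∃¬ _ _ (λ i → em (mem J (e i))) λ e∈J →
    pr (let a , a∈J , φa≈1 = unitOn J id in resp J (φ≈1⇒≈1 λ i → φa≈1 i (e∈J i)) a∈J)

  -- A maximal ideal omits some `e i`, hence lies in `M i`, and by maximality it contains `M i`.
  ⊆M⇒⊆Jacobson : ∀ {J} → (∀ i → J ⊆I M i) → ⊆Jacobson J
  ⊆M⇒⊆Jacobson J⊆M x x∈J N (N-proper , N-maximal) with i , e∉N ← proper⇒e∉ {N} N-proper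
    with N-maximal (M i) (e∉⇒⊆M N e∉N)
  ... | inj₁ M⊆N = M⊆N x (J⊆M i x x∈J)
  ... | inj₂ 1∈M = contradiction 1∈M (M-proper i)

  -- An ideal containing no `e i` would lie in every `M i`, hence in the Jacobson radical.
  vertex⇒e∈ : ∀ {J} → IsVertex J → ∃ λ i → mem J (e i)
  vertex⇒e∈ {J} (_ , J⊈Jac)
    with i , ¬e∉ ← ¬∀⟶∃¬ _ (λ i → ¬ mem J (e i)) (λ i → ¬? (em (mem J (e i))))
                     (λ e∉J → J⊈Jac (⊆M⇒⊆Jacobson {J} λ i → e∉⇒⊆M J (e∉J i))) =
    i , decidable-stable (em (mem J (e i))) ¬e∉

  e∈∧e∉⇒vertex : ∀ {J i j} → mem J (e i) → ¬ mem J (e j) → IsVertex J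
  e∈∧e∉⇒vertex {J} {i} {j} e∈J e∉J =
    (λ 1∈J → e∉J (resp J (*-identityʳ (e j)) (mulˡ J (e j) 1∈J))) ,
    λ J⊆Jac → e∉M i (J⊆Jac (e i) e∈J (M i) (M-maximal i))

  e∉? : ∀ J i → Dec (¬ mem J (e i))
  e∉? J i = ¬? (em (mem J (e i)))

  -- Cosupports and comaximality

  cosupport : Ideal → Subset (suc n)
  cosupport J = select (e∉? J)

  ∈-cosupport⁺ : ∀ {J i} → ¬ mem J (e i) → i ∈ cosupport J
  ∈-cosupport⁺ {J} = ∈-select⁺ (e∉? J)

  ∈-cosupport⁻ : ∀ {J i} → i ∈ cosupport J → ¬ mem J (e i)
  ∈-cosupport⁻ {J} = ∈-select⁻ (e∉? J)

  e∈⇒∉-cosupport : ∀ {J i} → mem J (e i) → i ∉ cosupport J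
  e∈⇒∉-cosupport {J} e∈J i∈ = ∈-cosupport⁻ {J} i∈ e∈J

  cosupport-cong : ∀ {J K} → J ≐ K → cosupport J ≡ cosupport K
  cosupport-cong {J} {K} (J⊆K , K⊆J) = ⊆-antisym
    (λ i∈ → ∈-cosupport⁺ {K} (∈-cosupport⁻ {J} i∈ ∘ K⊆J _))
    (λ i∈ → ∈-cosupport⁺ {J} (∈-cosupport⁻ {K} i∈ ∘ J⊆K _))

  -- Two ideals that both omit `e i` lie in the same proper ideal `M i`.
  comaximal⇒disjoint : ∀ {J K} → Comaximal J K → Disjoint (cosupport J) (cosupport K)
  comaximal⇒disjoint {J} {K} (a , b , a∈J , b∈K , a+b≈1) i i∈J i∈K =
    M-proper i (resp (M i) a+b≈1 (add (M i) (e∉⇒⊆M J (∈-cosupport⁻ {J} i∈J) a a∈J)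
                                            (e∉⇒⊆M K (∈-cosupport⁻ {K} i∈K) b b∈K)))

  disjoint⇒comaximal : ∀ {J K} → Disjoint (cosupport J) (cosupport K) → Comaximal J K
  disjoint⇒comaximal {J} {K} d = cover⇒comaximal J K cover
    where
    cover : ∀ i → mem J (e i) ⊎ mem K (e i)
    cover i with em (mem J (e i)) | em (mem K (e i))
    ... | yes e∈J | _       = inj₁ e∈J
    ... | no  _   | yes e∈K = inj₂ e∈K
    ... | no  e∉J | no  e∉K = contradiction (∈-cosupport⁺ {K} e∉K) (d i (∈-cosupport⁺ {J} e∉J))

  -- The product ideal with component `Js i` on the factors in `S` and the whole ring on the others;
  -- proper components make its cosupport `S`.
  box : (∀ i → I.Ideal {i}) → Subset (suc n) → Ideal
  box Js S = record
    { mem  = λ x → ∀ i → i ∈ S → mem (pullback (Js i)) x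
    ; resp = λ x≈y x∈ i i∈S → resp (pullback (Js i)) x≈y (x∈ i i∈S)
    ; has0 = λ i _ → has0 (pullback (Js i))
    ; add  = λ x∈ y∈ i i∈S → add (pullback (Js i)) (x∈ i i∈S) (y∈ i i∈S)
    ; mulˡ = λ r x∈ i i∈S → mulˡ (pullback (Js i)) r (x∈ i i∈S)
    }

  module _ (Js : ∀ i → I.Ideal {i}) (Js-proper : ∀ i → I.Proper (Js i)) {S : Subset (suc n)} where

    ∈⇒e∉box : ∀ {i} → i ∈ S → ¬ mem (box Js S) (e i)
    ∈⇒e∉box {i} i∈S e∈ = Js-proper i (I.resp (Js i) (φ-ι-≡ i A.1#) (e∈ i i∈S))

    ∉⇒e∈box : ∀ {i} → i ∉ S → mem (box Js S) (e i)
    ∉⇒e∈box {i} i∉S j j∈S =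
      I.resp (Js j) (A.sym (φ-ι-≢ (λ i≡j → i∉S (subst (_∈ S) (sym i≡j) j∈S)) A.1#)) (I.has0 (Js j))

    cosupport-box : cosupport (box Js S) ≡ S
    cosupport-box = ⊆-antisym
      (λ {i} i∈ → decidable-stable (i ∈? S) (∈-cosupport⁻ {box Js S} i∈ ∘ ∉⇒e∈box))
      (λ i∈S → ∈-cosupport⁺ {box Js S} (∈⇒e∉box i∈S))

    box-vertex : Nonempty S → (∃ λ i → i ∉ S) → IsVertex (box Js S)
    box-vertex (i , i∈S) (j , j∉S) = e∈∧e∉⇒vertex {box Js S} {j} {i} (∉⇒e∈box j∉S) (∈⇒e∉box i∈S)

  -- Nonzero maximal ideals and twin vertices

  ι-∈ : ∀ (Js : ∀ i → I.Ideal {i}) {i z} → I.mem (Js i) z → ∀ j → I.mem (Js j) (φ (ι i z) j)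
  ι-∈ Js {i} {z} z∈J j with i ≟ j
  ... | yes refl = I.resp (Js i) (A.sym (φ-ι-≡ i z)) z∈J
  ... | no  i≢j  = I.resp (Js j) (A.sym (φ-ι-≢ i≢j z)) (I.has0 (Js j))

  -- The ideal of `R` generated by `ι i x` omits `e i`, since a multiple equal to `e i` would invert
  -- `x` in the factor. It therefore lies in `M i`.
  nonunit⇒∈𝔪 : ∀ {i x} → (∀ u → ¬ u A.* x A.≈ A.1#) → I.mem (𝔪 i) x
  nonunit⇒∈𝔪 {i} {x} nonunit = I.resp (𝔪 i) (φ-ι-≡ i x)
    (e∉⇒⊆M (principal (ι i x)) e∉principal (ι i x) (1# , lift (*-identityˡ _)))
    where
    e∉principal : ¬ mem (principal (ι i x)) (e i)
    e∉principal (u , lift u*ιx≈e) = nonunit (φ u i)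
      (A.trans (A.*-congˡ (A.sym (φ-ι-≡ i x)))
        (A.trans (A.sym (φ-* u (ι i x) i)) (A.trans (φ-cong i u*ιx≈e) (φ-ι-≡ i A.1#))))

  module _ (nonreduced : ∀ i → I.HasNonzeroAnnihilatingIdeal {i}) where

    -- A nonzero element of the annihilated ideal is killed by some `r` that is not 0, so it is not
    -- a unit.
    𝔪-nonzero : ∀ i → ∃ λ z → I.mem (𝔪 i) z × ¬ z A.≈ A.0#
    𝔪-nonzero i with J , (z , z∈J , z≉0) , r , r≉0 , rJ≈0 ← nonreduced i =
      z , nonunit⇒∈𝔪 (Id.zeroDivisor-nonunit r≉0 (rJ≈0 z z∈J)) , z≉0

    1≉0 : ∀ i → ¬ A.1# {i} A.≈ A.0#
    1≉0 i 1≈0 = 𝔪-proper i (I.resp (𝔪 i) (A.sym 1≈0) (I.has0 (𝔪 i)))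

    zeros : ∀ i → I.Ideal {i}
    zeros i = IdealProperties.zeroIdeal (Rs i)

    zeros-proper : ∀ i → I.Proper (zeros i)
    zeros-proper i (lift 1≈0) = 1≉0 i 1≈0

    box-𝔪⊈box-0 : ∀ {S} → Nonempty S → ¬ box 𝔪 S ⊆I box zeros S
    box-𝔪⊈box-0 {S} (i , i∈S) ⊆ with z , z∈m , z≉0 ← 𝔪-nonzero i
      with lift φz≈0 ← ⊆ (ι i z) (λ j _ → ι-∈ 𝔪 z∈m j) i i∈S = z≉0 (A.trans (A.sym (φ-ι-≡ i z)) φz≈0)

    module _ {k} {vs : Fin k → Ideal} (enumeration : VertexEnumeration k vs) where

      private
        C : Fin k → Subset (suc n)
        C v = cosupport (vs v)

        isVertex = proj₁ enumeration
        complete = proj₁ (proj₂ enumeration)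

      nonempty : ∀ v → Nonempty (C v)
      nonempty v with i , e∉ ← proper⇒e∉ {vs v} (proj₁ (isVertex v)) = i , ∈-cosupport⁺ {vs v} e∉

      proper : ∀ v → ∃ λ i → i ∉ C v
      proper v with i , e∈ ← vertex⇒e∈ {vs v} (isVertex v) = i , e∈⇒∉-cosupport {vs v} e∈

      disjoint⇒adj : ∀ {u v} → Disjoint (C u) (C v) → ΓAdj vs u v
      disjoint⇒adj {u} {v} d = u≢v , disjoint⇒comaximal {vs u} {vs v} d
        where
        u≢v : u ≢ v
        u≢v refl with i , i∈u ← nonempty u = d i i∈u i∈u

      -- The boxes over `S` built from the maximal ideals and from the zero ideals have the same
      -- cosupport, and differ because each `𝔪 i` is nonzero.
      twins : ∀ S → Nonempty S → (∃ λ i → i ∉ S) → ∃₂ λ u v → u ≢ v × C u ≡ S × C v ≡ S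
      twins S ne pr
        with u , m⊆u , u⊆m ← complete (box 𝔪 S) (box-vertex 𝔪 𝔪-proper ne pr)
           | v , 0⊆v , v⊆0 ← complete (box zeros S) (box-vertex zeros zeros-proper ne pr) =
        u , v , (λ { refl → box-𝔪⊈box-0 ne λ x → v⊆0 x ∘ m⊆u x }) ,
        trans (cosupport-cong {vs u} {box 𝔪 S} (u⊆m , m⊆u)) (cosupport-box 𝔪 𝔪-proper) ,
        trans (cosupport-cong {vs v} {box zeros S} (v⊆0 , 0⊆v)) (cosupport-box zeros zeros-proper)

      sdim-Γ : ∃ λ s → s ℕ.+ n ℕ.* 2 ≡ k × GraphNotions.HasSdim (ΓAdj vs) s
      sdim-Γ = DisjointnessGraph.sdim (ΓAdj vs) C nonempty proper
        (λ {u} {v} → comaximal⇒disjoint {vs u} {vs v} ∘ proj₂) disjoint⇒adj twins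

open import Data.Nat using (_+_; _*_)

theorem3p4 : ∀ {c ℓ : Level} (R : CommutativeRing c ℓ) (n : ℕ) .{{_ : NonZero n}}
    (Rs : Fin n → CommutativeRing c ℓ) →
    RingNotions.FinitelyManyIdeals R →
    IsoToProduct R n Rs →
    (∀ i → RingNotions.Artinian (Rs i)) →
    (∀ i → RingNotions.Local (Rs i)) →
    (∀ i → RingNotions.HasNonzeroAnnihilatingIdeal (Rs i)) →
    (k : ℕ) (vs : Fin k → RingNotions.Ideal R) →
    RingNotions.VertexEnumeration R k vs →
    Σ ℕ λ s → (s + 2 * n ≡ k + 2) × GraphNotions.HasSdim (RingNotions.ΓAdj R vs) s
theorem3p4 R (suc n) Rs finite iso _ local nonreduced k vs enumeration =
  map₂ (map₁ count) (ProductOfLocalRings.sdim-Γ R Rs finite iso local nonreduced {vs = vs} enumeration)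
  where
  -- Here `n` is one less than the number of factors, so the family size 2n is twice that number
  -- minus 2.
  count : ∀ {s} → s + n * 2 ≡ k → s + 2 * suc n ≡ k + 2
  count {s} s+n*2≡k = trans (cong (s +_) (trans (ℕ.*-comm 2 (suc n)) (ℕ.+-comm 2 (n * 2))))
    (trans (sym (ℕ.+-assoc s (n * 2) 2)) (cong (_+ 2) s+n*2≡k))
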